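{- Let $n \geq 2$ be an integer. If $n$ is even, then $\mathrm{ParseWords}(\mathrm{LeftCombTree}(n), \mathrm{RightCombTree}(n)) = \{0 1^{n-2} 2\}$. If $n$ is odd (so $n \geq 3$), then $\mathrm{ParseWords}(\mathrm{LeftCombTree}(n), \mathrm{RightCombTree}(n)) = \{0 1^{n-2} 0\}$. (Here sets of equivalence classes are written by listing one representative of each class.)
   Context: A binary tree is a rooted ordered tree in which each vertex has either $0$ or $2$ children; its leaves are ordered left to right. Let $G$ be the context-free grammar with start symbols $0,1,2$ and rules $0\to 12$, $0\to 21$, $1\to 02$, $1\to 20$, $2\to 01$, $2\to 10$. An $n$-leaf binary tree $T$ parses a word $w$ of length $n$ on $\{0,1,2\}$ if there is a labeling of the vertices of $T$ by $0,1,2$ such that the leaves, from left to right, are labeled with the letters of $w$, and at every internal vertex the label of the vertex together with the labels of its left and right children form a rule of $G$ (i.e. the three labels are pairwise distinct). If $T$ parses $w$, it also parses every word obtained from $w$ by permuting the alphabet $\{0,1,2\}$. For $n$-leaf binary trees $T_1,T_2$, $\mathrm{ParseWords}(T_1,T_2)$ denotes the set of equivalence classes (under permutations of the alphabet $\{0,1,2\}$) of words parsed by both $T_1$ and $T_2$; it is written by listing one representative of each class. The level of a vertex is its distance from the root. A path tree is a binary tree with at most two vertices on each level. For $n\ge 2$, $n$-leaf path trees correspond bijectively to words $x_1\cdots x_{n-2}$ on $\{l,r\}$: $x_j=l$ (resp. $x_j=r$) means that, of the two vertices on level $j$, the left (resp. right) one has children. $\mathrm{LeftCombTree}(n)$ is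 the $n$-leaf path tree corresponding to $l^{n-2}$, and $\mathrm{RightCombTree}(n)$ is the $n$-leaf path tree corresponding to $r^{n-2}$. -}

module Defs where

open import Data.Fin.Base using (Fin)
open import Data.Fin.Patterns using (0F; 1F; 2F)
open import Data.Fin.Permutation using (Permutation′; _⟨$⟩ʳ_)
open import Data.List.Base as List using (List; []; _∷_; length; replicate)
open import Data.Nat.Base using (ℕ; suc; _+_; _∸_)
open import Data.Nat.Properties using (+-comm)
open import Data.Product.Base using (∃-syntax; Σ-syntax; _×_)
open import Data.Tree.Binary as Tree using (Tree; leaf; node; #leaves; module Leaves)
open import Data.Unit.Base using (⊤; tt)
open import Function.Base using (const)
open import Level using (0ℓ)
open import Relation.Binary.Core using (Rel)
open import Relation.Binary.PropositionalEquality.Core using (_≡_; refl; trans; cong)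
open import Relation.Unary using (Pred; _∩_)

Letter : Set
Letter = Fin 3

Word : Set
Word = List Letter

BinaryTree : Set
BinaryTree = Tree ⊤ ⊤

LabelledTree : Set
LabelledTree = Tree Letter Letter

shape : LabelledTree → BinaryTree
shape = Tree.map (const tt) (const tt)

rootLabel : LabelledTree → Letter
rootLabel (leaf x)     = x
rootLabel (node _ x _) = x

data Rule : Letter → Letter → Letter → Set where
  0→12 : Rule 0F 1F 2F
  0→21 : Rule 0F 2F 1F
  1→02 : Rule 1F 0F 2F
  1→20 : Rule 1F 2F 0F
  2→01 : Rule 2F 0F 1F
  2→10 : Rule 2F 1F 0F

data IsParseTree : LabelledTree → Set where
  leaf : ∀ {x} → IsParseTree (leaf x)
  node : ∀ {l x r} → IsParseTree l → Rule x (rootLabel l) (rootLabel r) →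
         IsParseTree r → IsParseTree (node l x r)

-- The length of w is forced to be the number of leaves of T.
Parses : BinaryTree → Pred Word 0ℓ
Parses T w = ∃[ U ] shape U ≡ T × Leaves.toList U ≡ w × IsParseTree U

infix 4 _∼_
_∼_ : Rel Word 0ℓ
v ∼ w = Σ[ π ∈ Permutation′ 3 ] List.map (π ⟨$⟩ʳ_) v ≡ w

-- A set of equivalence classes is encoded as the set of all words
-- representing one of its members; equality of two such sets is _≐_.
-- Classes S is the set of the classes of the words in S.
Classes : Pred Word 0ℓ → Pred Word 0ℓ
Classes S w = ∃[ v ] S v × v ∼ w

ParseWords : BinaryTree → BinaryTree → Pred Word 0ℓ
ParseWords T₁ T₂ = Classes (Parses T₁ ∩ Parses T₂)

data Side : Set where
  l r : Side

-- The first letter says which child of the root is internal, and the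
-- remaining letters describe the subtree rooted at that child.
pathTree : List Side → BinaryTree
pathTree []       = node (leaf tt) tt (leaf tt)
pathTree (l ∷ xs) = node (pathTree xs) tt (leaf tt)
pathTree (r ∷ xs) = node (leaf tt) tt (pathTree xs)

#leaves-pathTree : ∀ xs → #leaves (pathTree xs) ≡ 2 + length xs
#leaves-pathTree []       = refl
#leaves-pathTree (l ∷ xs) = trans (+-comm _ 1) (cong suc (#leaves-pathTree xs))
#leaves-pathTree (r ∷ xs) = cong suc (#leaves-pathTree xs)

-- The truncated subtraction makes these meaningful only for n ≥ 2.
LeftCombTree RightCombTree : ℕ → BinaryTree
LeftCombTree  n = pathTree (replicate (n ∸ 2) l)
RightCombTree n = pathTree (replicate (n ∸ 2) r)

{-# OPTIONS --safe #-}
-- If y is the root label of the right comb on w₂⋯wₙ, then w₂ differs from w₁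
-- (the left comb reads w₁w₂ first) and from y (it is a child of y), so w₂ is the
-- third letter x, which is also the root label forced by w₁ and y.  The two
-- combs then collapse to combs on y w₃⋯wₙ, the remaining right comb being
-- labelled w₁ at the root: the pair (w₁ , y) is swapped and x stays the same.
-- Hence the inner letters are all x, and the last letter is w₁ or
-- y according to the parity of n.
module Submission where

open import Defs
open import Data.Empty using (⊥-elim)
open import Data.Fin.Patterns using (0F; 1F; 2F)
open import Data.Fin.Permutation using (Permutation′; _⟨$⟩ʳ_; _∘ₚ_; id; transpose)
open import Data.List.Base using (map; _∷_; []; _++_; replicate)
open import Data.List.Properties using (∷-injectiveʳ; map-++; map-replicate; map-∘)
open import Data.Nat.Base using (ℕ; zero; suc; _+_; _≤_; _∸_; s≤s; z≤n)
open import Data.Nat.Divisibility using (_∣_; _∤_; _∣0; ∣-refl; ∣m+n∣m⇒∣n; ∣m∣n⇒∣m+n; >⇒∤)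
open import Data.Nat.Properties using (+-suc; +-comm; ≤-refl)
open import Data.Product.Base using (_×_; _,_; ∃-syntax; Σ-syntax)
open import Data.Tree.Binary using (leaf; node; module Leaves)
open import Data.Unit.Base using (tt)
open import Function.Base using (_∘_)
open import Relation.Binary.PropositionalEquality
  using (_≡_; refl; sym; trans; cong; cong₂; subst)
open import Relation.Unary using (_≐_; _⊆_; ｛_｝)

private
  variable
    a b c x y z : Letter
    u v w : Word
    A B : Set

Rule-swap : Rule x y z → Rule x z y
Rule-swap 0→12 = 0→21
Rule-swap 0→21 = 0→12
Rule-swap 1→02 = 1→20
Rule-swap 1→20 = 1→02
Rule-swap 2→01 = 2→10
Rule-swap 2→10 = 2→01

Rule-rotate : Rule x y z → Rule z x y
Rule-rotate 0→12 = 2→01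
Rule-rotate 0→21 = 1→02
Rule-rotate 1→02 = 2→10
Rule-rotate 1→20 = 0→12
Rule-rotate 2→01 = 1→20
Rule-rotate 2→10 = 0→21

-- `c` differs from its sibling `a` and from its parent `y`, so it is the third letter; then `b` and
-- `z` are forced too.
Rule-exchange : Rule x a y → Rule b a c → Rule y c z → c ≡ x × b ≡ y × z ≡ a
Rule-exchange 0→12 2→10 2→01 = refl , refl , refl
Rule-exchange 0→21 1→20 1→02 = refl , refl , refl
Rule-exchange 1→02 2→01 2→10 = refl , refl , refl
Rule-exchange 1→20 0→21 0→12 = refl , refl , refl
Rule-exchange 2→01 1→02 1→20 = refl , refl , refl
Rule-exchange 2→10 0→12 0→21 = refl , refl , refl

-- A rule is an ordering of the three letters, hence the image of `1→02` under a permutation.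
Rule→Permutation : Rule x a y → Σ[ π ∈ Permutation′ 3 ]
  π ⟨$⟩ʳ 0F ≡ a × π ⟨$⟩ʳ 1F ≡ x × π ⟨$⟩ʳ 2F ≡ y
Rule→Permutation 0→12 = transpose 0F 1F , refl , refl , refl
Rule→Permutation 0→21 = transpose 0F 2F ∘ₚ transpose 0F 1F , refl , refl , refl
Rule→Permutation 1→02 = id , refl , refl , refl
Rule→Permutation 1→20 = transpose 0F 2F , refl , refl , refl
Rule→Permutation 2→01 = transpose 1F 2F , refl , refl , refl
Rule→Permutation 2→10 = transpose 0F 1F ∘ₚ transpose 0F 2F , refl , refl , refl

∼-trans : u ∼ v → v ∼ w → u ∼ w
∼-trans {u} (π , refl) (ρ , refl) = π ∘ₚ ρ , map-∘ u

-- The swap mirrors one collapse of the two combs, so the inductions need no case split on parity.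
alternate : ℕ → A → A → A
alternate zero    a b = b
alternate (suc m) a b = alternate m b a

alternate-map : ∀ (f : A → B) m {a b} → f (alternate m a b) ≡ alternate m (f a) (f b)
alternate-map f zero    = refl
alternate-map f (suc m) = alternate-map f m

alternate-even : ∀ m {a b : A} → 2 ∣ m → alternate m a b ≡ b
alternate-even 0             2∣m = refl
alternate-even 1             2∣1 = ⊥-elim (>⇒∤ ≤-refl 2∣1)
alternate-even (suc (suc m)) 2∣m = alternate-even m (∣m+n∣m⇒∣n 2∣m ∣-refl)

alternate-odd : ∀ m {a b : A} → 2 ∤ m → alternate m a b ≡ a
alternate-odd 0             2∤0 = ⊥-elim (2∤0 (2 ∣0))
alternate-odd 1             2∤m = refl
alternate-odd (suc (suc m)) 2∤m = alternate-odd m (2∤m ∘ ∣m∣n⇒∣m+n ∣-refl)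

zigzag : ℕ → Letter → Letter → Letter → Word
zigzag m a x y = a ∷ replicate m x ++ alternate m a y ∷ []

map-zigzag : ∀ (f : Letter → Letter) m {a x y} →
             map f (zigzag m a x y) ≡ zigzag m (f a) (f x) (f y)
map-zigzag f m {a} {x} {y} = cong (f a ∷_) (trans
  (map-++ f (replicate m x) _)
  (cong₂ (λ v b → v ++ b ∷ []) (map-replicate f m x) (alternate-map f m)))

zigzag-∼ : ∀ m → Rule x a y → zigzag m 0F 1F 2F ∼ zigzag m a x y
zigzag-∼ m xay with π , refl , refl , refl ← Rule→Permutation xay =
  π , map-zigzag (π ⟨$⟩ʳ_) m

-- Unlike `pathTree`, these start from a single leaf, where the inductions end; the index counts
-- internal vertices.
leftComb rightComb : ℕ → BinaryTree
leftComb zero     = leaf tt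
leftComb (suc k)  = node (leftComb k) tt (leaf tt)
rightComb zero    = leaf tt
rightComb (suc k) = node (leaf tt) tt (rightComb k)

pathTree-l : ∀ m → pathTree (replicate m l) ≡ leftComb (suc m)
pathTree-l zero    = refl
pathTree-l (suc m) = cong (λ T → node T tt (leaf tt)) (pathTree-l m)

pathTree-r : ∀ m → pathTree (replicate m r) ≡ rightComb (suc m)
pathTree-r zero    = refl
pathTree-r (suc m) = cong (node (leaf tt) tt) (pathTree-r m)

leftSubtree rightSubtree : BinaryTree → BinaryTree
leftSubtree (leaf x)      = leaf x
leftSubtree (node T _ _)  = T
rightSubtree (leaf x)     = leaf x
rightSubtree (node _ _ T) = T

-- A left comb evaluated from its deepest leaves: the first two letters are
-- replaced by the label of their parent until one letter remains.
data LeftFoldable : Word → Set where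
  [_] : ∀ a → LeftFoldable (a ∷ [])
  _∷_ : Rule b a c → LeftFoldable (b ∷ w) → LeftFoldable (a ∷ c ∷ w)

-- Descending the left spine, `w` collects the leaves to the right of `U`, and each vertex passed
-- contributes one folding step.
leftComb-foldable : ∀ k U → shape U ≡ leftComb k → IsParseTree U →
  LeftFoldable (rootLabel U ∷ w) → LeftFoldable (Leaves.toDiffList U w)
leftComb-foldable k       (leaf a)            _  leaf fold = fold
leftComb-foldable (suc k) (node U _ (leaf c)) eq (node p rule leaf) fold =
  leftComb-foldable k U (cong leftSubtree eq) p (rule ∷ fold)
leftComb-foldable (suc k) (node U _ (node _ _ _)) eq _ _ with () ← cong rightSubtree eq

foldable-rightComb : ∀ m V → shape V ≡ rightComb m → IsParseTree V →
  LeftFoldable (a ∷ Leaves.toList V) → Rule x a (rootLabel V) →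
  a ∷ Leaves.toList V ≡ zigzag m a x (rootLabel V)
foldable-rightComb zero    (leaf c) _ _ _ _ = refl
foldable-rightComb {a} (suc m) (node (leaf c) y V) eq (node leaf rule p) (rule′ ∷ fold) xay
  with refl , refl , refl ← Rule-exchange xay rule′ rule =
  -- The head given by the induction is the label of the collapsed vertex, not a letter of the word,
  -- so only the tail is kept.
  cong (λ w → a ∷ c ∷ w) (∷-injectiveʳ
    (foldable-rightComb m V (cong rightSubtree eq) p fold (Rule-swap xay)))
foldable-rightComb (suc m) (node (node _ _ _) y V) eq _ _ _ with () ← cong leftSubtree eq

combs-parse⇒zigzag : ∀ m → Parses (leftComb (suc m)) w → Parses (rightComb (suc m)) w →
  ∃[ a ] ∃[ x ] ∃[ y ] Rule x a y × w ≡ zigzag m a x y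
-- The first leaf of the right comb plays the role of `a`. The root labels of the two combs are not
-- assumed equal.
combs-parse⇒zigzag m (U , U≡ , refl , p) (node (leaf c) x V , V≡ , eq , node leaf rule q) =
  c , x , rootLabel V , rule ,
  trans (sym eq) (foldable-rightComb m V (cong rightSubtree V≡) q
    (subst LeftFoldable (sym eq) (leftComb-foldable (suc m) U U≡ p [ _ ])) rule)
combs-parse⇒zigzag m _ (node (node _ _ _) _ _ , V≡ , _) with () ← cong leftSubtree V≡

Parses-resp-≡ : ∀ {S T} → S ≡ T → Parses S w → Parses T w
Parses-resp-≡ refl p = p

-- The comb grows upward from `U`: attaching a leaf `x` gives root label `y`, which swaps
-- `rootLabel U` and `y` and keeps `x`.
leftComb-extend : ∀ m {k} U → shape U ≡ leftComb k → IsParseTree U →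
  Rule x (rootLabel U) y →
  Parses (leftComb (m + suc k))
         (Leaves.toDiffList U (replicate m x ++ alternate m (rootLabel U) y ∷ []))
leftComb-extend zero U eq p rule =
  node U _ (leaf _) , cong (λ T → node T tt (leaf tt)) eq , refl , node p rule leaf
leftComb-extend {x} {y} (suc m) {k} U eq p rule =
  Parses-resp-≡ (cong leftComb (+-suc m (suc k)))
    (leftComb-extend m (node U y (leaf x)) (cong (λ T → node T tt (leaf tt)) eq)
      (node p (Rule-swap (Rule-rotate rule)) leaf) (Rule-swap rule))

leftComb-parses-zigzag : ∀ m → Rule x a y → Parses (leftComb (suc m)) (zigzag m a x y)
leftComb-parses-zigzag m rule =
  Parses-resp-≡ (cong leftComb (+-comm m 1)) (leftComb-extend m (leaf _) refl leaf rule)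

-- The root label, which `Parses` forgets, is recorded because the rule at the next vertex up needs
-- it.
rightComb-parses-tail : ∀ m → Rule x a y →
  ∃[ V ] shape V ≡ rightComb m × Leaves.toList V ≡ replicate m x ++ alternate m a y ∷ []
         × IsParseTree V × rootLabel V ≡ y
rightComb-parses-tail zero rule = leaf _ , refl , refl , leaf , refl
rightComb-parses-tail (suc m) rule
  with V , V≡ , eq , p , refl ← rightComb-parses-tail m (Rule-swap rule) =
  node (leaf _) _ V , cong (node (leaf tt) tt) V≡ , cong (_ ∷_) eq
  , node leaf (Rule-rotate rule) p , refl

rightComb-parses-zigzag : ∀ m → Rule x a y → Parses (rightComb (suc m)) (zigzag m a x y)
rightComb-parses-zigzag m rule
  with V , V≡ , eq , p , refl ← rightComb-parses-tail m rule =
  node (leaf _) _ V , cong (node (leaf tt) tt) V≡ , cong (_ ∷_) eq , node leaf rule p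

ParseWords-combs : ∀ m →
  ParseWords (LeftCombTree (2 + m)) (RightCombTree (2 + m)) ≐ Classes ｛ zigzag m 0F 1F 2F ｝
ParseWords-combs m rewrite pathTree-l m | pathTree-r m = to , from
  where
  to : ParseWords (leftComb (suc m)) (rightComb (suc m)) ⊆ Classes ｛ zigzag m 0F 1F 2F ｝
  to (v , (p , q) , v∼w) with _ , _ , _ , rule , refl ← combs-parse⇒zigzag m p q =
    _ , refl , ∼-trans (zigzag-∼ m rule) v∼w

  from : Classes ｛ zigzag m 0F 1F 2F ｝ ⊆ ParseWords (leftComb (suc m)) (rightComb (suc m))
  from (_ , refl , v∼w) =
    -- `1→02` is the rule with `x`, `a`, `y` equal to 1, 0, 2, the letters of the representative.
    _ , (leftComb-parses-zigzag m 1→02 , rightComb-parses-zigzag m 1→02) , v∼w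

theorem4 : (n : ℕ) → 2 ≤ n →
    (2 ∣ n → ParseWords (LeftCombTree n) (RightCombTree n)
    ≐ Classes ｛ 0F ∷ replicate (n ∸ 2) 1F ++ 2F ∷ [] ｝)
    × (2 ∤ n → ParseWords (LeftCombTree n) (RightCombTree n)
    ≐ Classes ｛ 0F ∷ replicate (n ∸ 2) 1F ++ 0F ∷ [] ｝)
theorem4 (suc (suc m)) (s≤s (s≤s z≤n)) =
    -- `alternate (2 + m)` reduces to `alternate m`, so the parity of n decides the last letter
    -- directly.
    (λ 2∣n → subst IsCommonParseClass (alternate-even (2 + m) 2∣n) (ParseWords-combs m))
  , (λ 2∤n → subst IsCommonParseClass (alternate-odd (2 + m) 2∤n) (ParseWords-combs m))
  where
  IsCommonParseClass : Letter → Set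
  IsCommonParseClass c =
    ParseWords (LeftCombTree (2 + m)) (RightCombTree (2 + m))
      ≐ Classes ｛ 0F ∷ replicate m 1F ++ c ∷ [] ｝
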